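{- Let $p\geq 23$ be a prime. There exists a covering system of the integers such that all moduli are odd, greater than $1$, and pairwise distinct, except that $p$ is used exactly $p-5$ times as a modulus.
   Context: A covering system of the integers is a finite collection of congruences $x\equiv r_j \pmod{m_j}$ such that every integer satisfies at least one of them. "$p$ is used exactly $p-5$ times as a modulus" means exactly $p-5$ congruences of the system have modulus $p$, while all other moduli are distinct from each other and from $p$. -}

module Defs where

open import Data.Nat using (ℕ; _≟_; _<_; _∸_)
open import Data.Nat.Primality using (Prime)
open import Data.Integer using (ℤ; +_; _-_)
open import Data.Integer.Divisibility using (_∣_)
open import Data.Product using (_×_; proj₁; proj₂)
open import Data.List using (List; map; filter; length)
open import Data.List.Relation.Unary.Any using (Any)
open import Data.List.Relation.Unary.All using (All)
open import Data.List.Relation.Unary.Unique.Propositional using (Unique)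
open import Relation.Nullary using (¬_)
open import Relation.Binary.PropositionalEquality using (_≡_)

-- A congruence  x ≡ r (mod m)  is represented by the pair (m , r).
Congruence : Set
Congruence = ℕ × ℤ

modulus : Congruence → ℕ
modulus = proj₁

Satisfies : ℤ → Congruence → Set
Satisfies x c = + (proj₁ c) ∣ x - proj₂ c

IsCovering : List Congruence → Set
IsCovering S = (x : ℤ) → Any (Satisfies x) S

Odd : ℕ → Set
Odd m = ¬ (2 Data.Nat.Divisibility.∣ m)
  where import Data.Nat.Divisibility

moduli : List Congruence → List ℕ
moduli S = map modulus S

countModulus : ℕ → List Congruence → ℕ
countModulus p S = length (filter (λ m → m ≟ p) (moduli S))

otherModuli : ℕ → List Congruence → List ℕ
otherModuli p S = filter (λ m → Relation.Nullary.¬? (m ≟ p)) (moduli S)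
  where import Relation.Nullary

{-# OPTIONS --safe #-}

-- Fix K and describe an integer x, for q = 3, 5, 7, 11, 13, 17, 19, by its q-adic valuation j and its leading digit
-- d ∈ {1, …, q − 1}, that is x ≡ d qʲ (mod qʲ⁺¹).  The p − 5 congruences mod p leave five classes mod p, so the class
-- and the digits place x in the grid [5] × [2] × [4] × [6] × [10] × [12] × [16] × [18].  A subcube that fixes the
-- coordinates in a set P of primes becomes a congruence for every choice of valuations below K at the primes q ≠ p of P,
-- and its modulus ∏ qʲ⁺¹ (times p if p ∈ P) determines P and the valuations.  Hence a covering of the grid by subcubes with
-- pairwise different P gives distinct moduli, and there is one that uses each P other than ∅ and {p} once.  It reaches
-- every x whose valuations are below K.  If some q^K with K = p² divides x, then x is covered by the moduli qʲ⁺¹ p²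
-- with j < p², one for each class mod p².

module Submission where

open import Defs
open import Data.Bool using (Bool; true; false; T; _∨_; if_then_else_)
open import Data.Bool.ListAction using (any; all)
open import Data.Bool.Properties using (T-∨)
open import Data.Fin using (Fin; zero; suc)
open import Data.Integer as ℤ using (ℤ; +_)
open import Data.Integer.DivMod using (_%ℕ_; _/ℕ_; n%ℕd<d; a≡a%ℕn+[a/ℕn]*n)
import Data.Integer.Divisibility.Signed as ℤ∣
open ℤ∣ using () renaming (_∣_ to _∣ℤ_)
import Data.Integer.Properties as ℤₚ
open import Data.Integer.Tactic.RingSolver using (solve-∀)
open import Data.List using (List; []; _∷_; _++_; map; concatMap; applyUpTo; cartesianProductWith; allFin; length; filter)
open import Data.List.Membership.Propositional using (_∈_)
open import Data.List.Membership.Propositional.Properties using (∈-applyUpTo⁺; ∈-applyUpTo⁻; ∈-allFin)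
open import Data.List.Properties using (length-applyUpTo; length-map; map-∘; map-++; ++-identityʳ;
  filter-++; filter-all; filter-none)
open import Data.List.Relation.Unary.All as All using (All; []; _∷_)
import Data.List.Relation.Unary.All.Properties as AllP
open import Data.List.Relation.Unary.AllPairs as AllPairs using (AllPairs; []; _∷_)
import Data.List.Relation.Unary.AllPairs.Properties as AllPairsP
open import Data.List.Relation.Unary.Any as Any using (Any; here; there)
import Data.List.Relation.Unary.Any.Properties as AnyP
open import Data.List.Relation.Unary.Unique.Propositional using (Unique)
import Data.List.Relation.Unary.Unique.Propositional.Properties as UniqueP
open import Data.Nat as ℕ using (ℕ; zero; suc; _+_; _*_; _∸_; _^_; _≤_; _<_; z≤n; s≤s; NonZero; pred; >-nonZero)
open import Data.Nat.Coprimality as Coprimality using (Coprime; coprime?; prime⇒coprime; coprime-divisor; coprime-Bézout)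
open import Data.Nat.Divisibility using (_∣_; ∣-trans; ∣-refl; m∣m*n; 1∣_)
open import Data.Nat.GCD using (module Bézout)
open import Data.Nat.Primality using (Prime)
open import Data.Nat.Properties
open import Data.Product using (Σ; ∃; ∃₂; _×_; _,_; proj₁; proj₂)
open import Data.Sum using (_⊎_; inj₁; inj₂)
open import Data.Unit using (tt)
open import Data.Vec as Vec using (Vec; []; _∷_; lookup; replicate)
open import Data.Vec.Properties using (∷-injective)
open import Data.Vec.Relation.Binary.Pointwise.Inductive using (Pointwise; []; _∷_)
open import Data.Vec.Relation.Unary.All as VecAll using ([]; _∷_)
open import Data.Vec.Relation.Unary.AllPairs using ([]; _∷_; allPairs?) renaming (AllPairs to VecAllPairs)
open import Function using (_∘_; case_of_; Equivalence)
open import Relation.Binary.PropositionalEquality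
open import Relation.Nullary using (¬?; yes; no; contradiction)
open import Relation.Nullary.Decidable using (toWitness; _×-dec_)

private
  variable
    n : ℕ

-- Products of powers of pairwise coprime bases, and unique factorization

coprime-* : ∀ {a b c} → Coprime a c → Coprime b c → Coprime (a * b) c
coprime-* {a} {b} {c} ac bc {d} (d∣ab , d∣c) = bc (coprime-divisor d⊥a d∣ab , d∣c)
  where
  d⊥a : Coprime d a
  d⊥a (e∣d , e∣a) = ac (e∣a , ∣-trans e∣d d∣c)

coprime-^ : ∀ {a c} e → Coprime a c → Coprime (a ^ e) c
coprime-^ zero    _  = Coprimality.1-coprimeTo _
coprime-^ (suc e) ac = coprime-* ac (coprime-^ e ac)

value : Vec ℕ n → Vec ℕ n → ℕ
value []       []       = 1
value (q ∷ qs) (e ∷ es) = q ^ e * value qs es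

coprime-value : ∀ {c} {qs : Vec ℕ n} → VecAll.All (λ q → Coprime q c) qs → ∀ es → Coprime (value qs es) c
coprime-value []       []       = Coprimality.1-coprimeTo _
coprime-value (h ∷ hs) (e ∷ es) = coprime-* (coprime-^ e h) (coprime-value hs es)

coprime-head : ∀ {q} {qs : Vec ℕ n} → VecAll.All (Coprime q) qs → ∀ es → Coprime q (value qs es)
coprime-head h es = Coprimality.sym (coprime-value (VecAll.map Coprimality.sym h) es)

value-nonZero : ∀ {qs : Vec ℕ n} → VecAll.All (1 <_) qs → ∀ es → NonZero (value qs es)
value-nonZero []         []       = _
value-nonZero (1<q ∷ hs) (e ∷ es) = m*n≢0 _ _ {{m^n≢0 _ e {{>-nonZero (<-trans (s≤s z≤n) 1<q)}}}} {{value-nonZero hs es}}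

-- Cancel `q` from both sides until one exponent is zero. If the other is still positive, `q`
-- divides the opposite cofactor, and coprimality forces `q` to be 1.
q^e*A≡q^f*B : ∀ {q A B} → 1 < q → Coprime q A → Coprime q B → ∀ e f → q ^ e * A ≡ q ^ f * B → e ≡ f × A ≡ B
q^e*A≡q^f*B {q} {A} {B} 1<q qA qB zero zero eq = refl , trans (sym (*-identityˡ A)) (trans eq (*-identityˡ B))
q^e*A≡q^f*B {q} {A} {B} 1<q qA qB zero (suc f) eq =
  contradiction (sym (qA (∣-refl , subst (q ∣_) (trans (sym eq) (*-identityˡ A)) (∣-trans (m∣m*n (q ^ f)) (m∣m*n B)))))
    (<⇒≢ 1<q)
q^e*A≡q^f*B {q} {A} {B} 1<q qA qB (suc e) zero eq =
  contradiction (sym (qB (∣-refl , subst (q ∣_) (trans eq (*-identityˡ B)) (∣-trans (m∣m*n (q ^ e)) (m∣m*n A)))))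
    (<⇒≢ 1<q)
q^e*A≡q^f*B {q} {A} {B} 1<q qA qB (suc e) (suc f) eq =
  let e≡f , A≡B = q^e*A≡q^f*B 1<q qA qB e f (*-cancelˡ-≡ _ _ q {{>-nonZero (<-trans (s≤s z≤n) 1<q)}}
                    (trans (sym (*-assoc q _ A)) (trans eq (*-assoc q _ B))))
  in cong suc e≡f , A≡B

-- Read off one base at a time. Questions about equal moduli thus become questions about equal
-- exponent vectors.
value-injective : ∀ {qs : Vec ℕ n} → VecAll.All (1 <_) qs → VecAllPairs Coprime qs →
                  ∀ es fs → value qs es ≡ value qs fs → es ≡ fs
value-injective []         []         []       []       _  = refl
value-injective (1<q ∷ hs) (c ∷ cs) (e ∷ es) (f ∷ fs) eq =
  let e≡f , eq′ = q^e*A≡q^f*B 1<q (coprime-head c es) (coprime-head c fs) e f eq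
  in cong₂ _∷_ e≡f (value-injective hs cs es fs eq′)

-- Bézout's identity over the integers and the Chinese remainder theorem

bézout : ∀ {a b} → Coprime a b → ∃₂ λ s t → + a ℤ.* s ℤ.+ + b ℤ.* t ≡ + 1
bézout {a} {b} c with coprime-Bézout c
... | Bézout.+- x y eq = + x , ℤ.- + y , (begin
  + a ℤ.* + x ℤ.+ + b ℤ.* ℤ.- + y            ≡⟨ rearrange (+ a) (+ x) (+ b) (+ y) ⟩
  + x ℤ.* + a ℤ.- + y ℤ.* + b                ≡⟨ cong (ℤ._- + y ℤ.* + b) (sym (ℤₚ.pos-* x a)) ⟩
  + (x * a) ℤ.- + y ℤ.* + b                  ≡⟨ cong (λ z → + z ℤ.- + y ℤ.* + b) (sym eq) ⟩
  + 1 ℤ.+ + (y * b) ℤ.- + y ℤ.* + b          ≡⟨ cong (λ z → + 1 ℤ.+ z ℤ.- + y ℤ.* + b) (ℤₚ.pos-* y b) ⟩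
  + 1 ℤ.+ + y ℤ.* + b ℤ.- + y ℤ.* + b        ≡⟨ cancel (+ y ℤ.* + b) ⟩
  + 1 ∎)
  where
  open ≡-Reasoning
  rearrange : ∀ a x b y → a ℤ.* x ℤ.+ b ℤ.* ℤ.- y ≡ x ℤ.* a ℤ.- y ℤ.* b
  rearrange = solve-∀
  cancel : ∀ z → + 1 ℤ.+ z ℤ.- z ≡ + 1
  cancel = solve-∀
... | Bézout.-+ x y eq = ℤ.- + x , + y , (begin
  + a ℤ.* ℤ.- + x ℤ.+ + b ℤ.* + y            ≡⟨ rearrange (+ a) (+ x) (+ b) (+ y) ⟩
  + y ℤ.* + b ℤ.- + x ℤ.* + a                ≡⟨ cong (ℤ._- + x ℤ.* + a) (sym (ℤₚ.pos-* y b)) ⟩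
  + (y * b) ℤ.- + x ℤ.* + a                  ≡⟨ cong (λ z → + z ℤ.- + x ℤ.* + a) (sym eq) ⟩
  + 1 ℤ.+ + (x * a) ℤ.- + x ℤ.* + a          ≡⟨ cong (λ z → + 1 ℤ.+ z ℤ.- + x ℤ.* + a) (ℤₚ.pos-* x a) ⟩
  + 1 ℤ.+ + x ℤ.* + a ℤ.- + x ℤ.* + a        ≡⟨ cancel (+ x ℤ.* + a) ⟩
  + 1 ∎)
  where
  open ≡-Reasoning
  rearrange : ∀ a x b y → a ℤ.* ℤ.- x ℤ.+ b ℤ.* y ≡ y ℤ.* b ℤ.- x ℤ.* a
  rearrange = solve-∀
  cancel : ∀ z → + 1 ℤ.+ z ℤ.- z ≡ + 1
  cancel = solve-∀

-- With `a s + b t = 1` the witness is `r = u + a s (v - u)`. Then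
-- `x - r = b t (x - u) + a s (x - v)`, and both terms are multiples of `a b`. A covering uses this
-- direction: whatever solves the separate congruences satisfies the merged one.
chineseRemainder : ∀ {a b} → Coprime a b → ∀ u v →
  Σ ℤ λ r → ∀ x → + a ∣ℤ x ℤ.- u → + b ∣ℤ x ℤ.- v → + (a * b) ∣ℤ x ℤ.- r
chineseRemainder {a} {b} c u v with bézout c
... | s , t , eq = u ℤ.+ + a ℤ.* s ℤ.* (v ℤ.- u) , λ {
  x (ℤ∣.divides α eqα) (ℤ∣.divides β eqβ) → ℤ∣.divides (s ℤ.* β ℤ.+ t ℤ.* α) (begin
    x ℤ.- (u ℤ.+ + a ℤ.* s ℤ.* (v ℤ.- u))
      ≡⟨ expand x u v (+ a ℤ.* s) ⟩
    (+ 1 ℤ.- + a ℤ.* s) ℤ.* (x ℤ.- u) ℤ.+ + a ℤ.* s ℤ.* (x ℤ.- v)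
      ≡⟨ cong (λ z → (z ℤ.- + a ℤ.* s) ℤ.* (x ℤ.- u) ℤ.+ + a ℤ.* s ℤ.* (x ℤ.- v)) (sym eq) ⟩
    (+ a ℤ.* s ℤ.+ + b ℤ.* t ℤ.- + a ℤ.* s) ℤ.* (x ℤ.- u) ℤ.+ + a ℤ.* s ℤ.* (x ℤ.- v)
      ≡⟨ cong₂ (λ y z → (+ a ℤ.* s ℤ.+ + b ℤ.* t ℤ.- + a ℤ.* s) ℤ.* y ℤ.+ + a ℤ.* s ℤ.* z) eqα eqβ ⟩
    (+ a ℤ.* s ℤ.+ + b ℤ.* t ℤ.- + a ℤ.* s) ℤ.* (α ℤ.* + a) ℤ.+ + a ℤ.* s ℤ.* (β ℤ.* + b)
      ≡⟨ collect (+ a) (+ b) s t α β ⟩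
    (s ℤ.* β ℤ.+ t ℤ.* α) ℤ.* (+ a ℤ.* + b)
      ≡⟨ cong ((s ℤ.* β ℤ.+ t ℤ.* α) ℤ.*_) (sym (ℤₚ.pos-* a b)) ⟩
    (s ℤ.* β ℤ.+ t ℤ.* α) ℤ.* + (a * b) ∎) }
  where
  open ≡-Reasoning
  expand : ∀ x u v z → x ℤ.- (u ℤ.+ z ℤ.* (v ℤ.- u)) ≡ (+ 1 ℤ.- z) ℤ.* (x ℤ.- u) ℤ.+ z ℤ.* (x ℤ.- v)
  expand = solve-∀
  collect : ∀ a b s t α β →
            (a ℤ.* s ℤ.+ b ℤ.* t ℤ.- a ℤ.* s) ℤ.* (α ℤ.* a) ℤ.+ a ℤ.* s ℤ.* (β ℤ.* b) ≡
            (s ℤ.* β ℤ.+ t ℤ.* α) ℤ.* (a ℤ.* b)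
  collect = solve-∀

data Solves (x : ℤ) : ∀ {n} → Vec ℕ n → Vec ℕ n → Vec ℕ n → Set where
  []  : Solves x [] [] []
  _∷_ : ∀ {q e u} {qs es us : Vec ℕ n} → + (q ^ e) ∣ℤ x ℤ.- + u → Solves x qs es us →
        Solves x (q ∷ qs) (e ∷ es) (u ∷ us)

crt : ∀ {qs : Vec ℕ n} → VecAllPairs Coprime qs → ∀ es us →
      Σ ℤ λ r → ∀ x → Solves x qs es us → + value qs es ∣ℤ x ℤ.- r
crt []       []       []       = + 0 , λ x _ → ℤ∣.∣ᵤ⇒∣ (1∣ _)
crt (c ∷ cs) (e ∷ es) (u ∷ us) =
  let r , hr = crt cs es us
      r′ , hr′ = chineseRemainder (coprime-^ e (coprime-head c es)) (+ u) r
  in r′ , λ { x (h ∷ hs) → hr′ x h (hr x hs) }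

-- Subcubes of a grid and a Boolean test for covering

-- In a subcube, coordinate 0 stands for a free coordinate.
data Matches : Vec ℕ n → Vec ℕ n → Set where
  []    : Matches [] []
  free  : ∀ {d} {c ds : Vec ℕ n} → Matches c ds → Matches (0 ∷ c) (d ∷ ds)
  fixed : ∀ {d} {c ds : Vec ℕ n} → Matches c ds → Matches (suc d ∷ c) (suc d ∷ ds)

InGrid : Vec ℕ n → Vec ℕ n → Set
InGrid = Pointwise (λ s d → d ∈ applyUpTo suc s)

isFree : Vec ℕ n → Bool
isFree []          = true
isFree (zero ∷ c)  = isFree c
isFree (suc _ ∷ _) = false

restrict : ℕ → List (Vec ℕ (suc n)) → List (Vec ℕ n)
restrict d []               = []
restrict d ((k ∷ c) ∷ cs) = if (k ℕ.≡ᵇ 0) ∨ (k ℕ.≡ᵇ d) then c ∷ restrict d cs else restrict d cs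

-- Branches on the first coordinate and keeps the cubes compatible with the chosen value. The test
-- `any isFree cs` closes a branch as soon as a surviving cube is free in all remaining coordinates.
-- This pruning makes evaluation feasible: the grid used below has 8294400 points.
covers : Vec ℕ n → List (Vec ℕ n) → Bool
covers []       cs = any isFree cs
covers (s ∷ ss) cs = any isFree cs ∨ all (λ d → covers ss (restrict d cs)) (applyUpTo suc s)

isFree⇒Matches : ∀ (c ds : Vec ℕ n) → T (isFree c) → Matches c ds
isFree⇒Matches []         []       _ = []
isFree⇒Matches (zero ∷ c) (_ ∷ ds) t = free (isFree⇒Matches c ds t)

anyFree⇒Matches : ∀ (cs : List (Vec ℕ n)) ds → T (any isFree cs) → Any (λ c → Matches c ds) cs
anyFree⇒Matches cs ds t = Any.map (λ {c} → isFree⇒Matches c ds) (AnyP.any⁻ isFree cs t)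

restrict-Matches : ∀ d (cs : List (Vec ℕ (suc n))) {ds} → Any (λ c → Matches c ds) (restrict (suc d) cs) →
                   Any (λ c → Matches c (suc d ∷ ds)) cs
restrict-Matches d ((zero ∷ c) ∷ cs)  (here h)  = here (free h)
restrict-Matches d ((zero ∷ c) ∷ cs)  (there h) = there (restrict-Matches d cs h)
restrict-Matches d ((suc k ∷ c) ∷ cs) h with k ℕ.≡ᵇ d | ≡ᵇ⇒≡ k d
restrict-Matches d ((suc k ∷ c) ∷ cs) h         | false | _   = there (restrict-Matches d cs h)
restrict-Matches d ((suc k ∷ c) ∷ cs) (there h) | true  | _   = there (restrict-Matches d cs h)
restrict-Matches d ((suc k ∷ c) ∷ cs) (here h)  | true  | k≡d with refl ← k≡d _ = here (fixed h)

covers-sound : ∀ (ss : Vec ℕ n) cs → T (covers ss cs) → ∀ {ds} → InGrid ss ds → Any (λ c → Matches c ds) cs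
covers-sound []       cs t [] = anyFree⇒Matches cs [] t
covers-sound (s ∷ ss) cs t {ds} (d∈ ∷ ds∈) with Equivalence.to T-∨ t
... | inj₁ t′ = anyFree⇒Matches cs ds t′
... | inj₂ t′ with ∈-applyUpTo⁻ suc d∈
...   | d , d<s , refl = restrict-Matches d cs
        (covers-sound ss (restrict (suc d) cs) (All.lookup (AllP.all⁺ _ (applyUpTo suc s) t′) d∈) ds∈)

-- Valuations and leading digits

-- For `0 < d < q` the witness `j` is the `q`-adic valuation of `x`; the range of `d` is recorded
-- separately by `InGrid`. For `K = 1` the condition is `x ≡ d` modulo `q`, so a residue class mod
-- `p` fits the same format.
Leading : ℕ → ℤ → ℕ → ℕ → Set
Leading K x q d = ∃ λ j → j < K × + (q ^ suc j) ∣ℤ x ℤ.- + (d * q ^ j)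

data Expansion (x : ℤ) : ∀ {n} → Vec ℕ n → Vec ℕ n → Vec ℕ n → Set where
  []  : Expansion x [] [] []
  _∷_ : ∀ {K q d} {Ks qs ds : Vec ℕ n} → Leading K x q d → Expansion x Ks qs ds →
        Expansion x (K ∷ Ks) (q ∷ qs) (d ∷ ds)

remainder-∣ : ∀ x q .{{_ : NonZero q}} → + q ∣ℤ x ℤ.- + (x %ℕ q)
remainder-∣ x q = ℤ∣.divides (x /ℕ q) (trans
  (cong (ℤ._- + (x %ℕ q)) (a≡a%ℕn+[a/ℕn]*n x q))
  (cancel (+ (x %ℕ q)) (x /ℕ q ℤ.* + q)))
  where
  cancel : ∀ r z → r ℤ.+ z ℤ.- r ≡ z
  cancel = solve-∀

-- Induction on `K`. If `x = y q^K`, look at `y` modulo `q`: remainder zero gives one more factor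
-- `q`, and a nonzero remainder is the leading digit at valuation `K`.
leading : ∀ {q} → 1 < q → ∀ K x → + (q ^ K) ∣ℤ x ⊎ ∃ λ d → d ∈ applyUpTo suc (pred q) × Leading K x q d
leading 1<q zero    x = inj₁ (ℤ∣.∣ᵤ⇒∣ (1∣ _))
leading {q@(suc q-1)} 1<q (suc K) x with leading 1<q K x
... | inj₂ (d , d∈ , j , j<K , h) = inj₂ (d , d∈ , j , m<n⇒m<1+n j<K , h)
... | inj₁ (ℤ∣.divides y eq) with y %ℕ q | n%ℕd<d y q | remainder-∣ y q
...   | zero  | _ | ℤ∣.divides z eq′ = inj₁ (ℤ∣.divides z (begin
          x                       ≡⟨ eq ⟩
          y ℤ.* + (q ^ K)         ≡⟨ cong (ℤ._* + (q ^ K)) (trans (sym (ℤₚ.+-identityʳ y)) eq′) ⟩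
          z ℤ.* + q ℤ.* + (q ^ K) ≡⟨ ℤₚ.*-assoc z (+ q) (+ (q ^ K)) ⟩
          z ℤ.* (+ q ℤ.* + (q ^ K)) ≡⟨ cong (z ℤ.*_) (sym (ℤₚ.pos-* q (q ^ K))) ⟩
          z ℤ.* + (q ^ suc K)     ∎))
  where open ≡-Reasoning
...   | suc r | s≤s r<q-1 | ℤ∣.divides z eq′ = inj₂ (suc r , ∈-applyUpTo⁺ suc r<q-1 , K , ≤-refl , ℤ∣.divides z (begin
          x ℤ.- + (suc r * q ^ K)                     ≡⟨ cong₂ ℤ._-_ eq (ℤₚ.pos-* (suc r) (q ^ K)) ⟩
          y ℤ.* + (q ^ K) ℤ.- + suc r ℤ.* + (q ^ K)   ≡⟨ factor y (+ suc r) (+ (q ^ K)) ⟩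
          (y ℤ.- + suc r) ℤ.* + (q ^ K)               ≡⟨ cong (ℤ._* + (q ^ K)) eq′ ⟩
          z ℤ.* + q ℤ.* + (q ^ K)                     ≡⟨ ℤₚ.*-assoc z (+ q) (+ (q ^ K)) ⟩
          z ℤ.* (+ q ℤ.* + (q ^ K))                   ≡⟨ cong (z ℤ.*_) (sym (ℤₚ.pos-* q (q ^ K))) ⟩
          z ℤ.* + (q ^ suc K)                         ∎))
  where
  open ≡-Reasoning
  factor : ∀ y r z → y ℤ.* z ℤ.- r ℤ.* z ≡ (y ℤ.- r) ℤ.* z
  factor = solve-∀

expansion : ∀ {qs : Vec ℕ n} → VecAll.All (1 <_) qs → ∀ K x →
            (∃ λ i → + (lookup qs i ^ K) ∣ℤ x) ⊎
            (∃ λ ds → InGrid (Vec.map pred qs) ds × Expansion x (replicate _ K) qs ds)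
expansion []         K x = inj₂ ([] , [] , [])
expansion (1<q ∷ hs) K x with leading 1<q K x | expansion hs K x
... | inj₁ deep          | _                    = inj₁ (zero , deep)
... | inj₂ _             | inj₁ (i , deep)      = inj₁ (suc i , deep)
... | inj₂ (d , d∈ , l) | inj₂ (ds , ds∈ , ls) = inj₂ (d ∷ ds , d∈ ∷ ds∈ , l ∷ ls)

-- The congruences that come from one subcube

-- Possible exponents of one prime in the modulus: 0 at a free coordinate, and valuation plus one at
-- a fixed coordinate, for the valuations below `K`.
levels : ℕ → ℕ → List ℕ
levels K zero    = 0 ∷ []
levels K (suc _) = applyUpTo suc K

exponents : Vec ℕ n → Vec ℕ n → List (Vec ℕ n)
exponents []       []      = [] ∷ []
exponents (K ∷ Ks) (d ∷ c) = cartesianProductWith _∷_ (levels K d) (exponents Ks c)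

-- Since `e` is the valuation plus one, `d * q ^ pred e` is the leading term. At a free coordinate
-- it is 0, taken modulo `q ^ 0 = 1`.
residues : Vec ℕ n → Vec ℕ n → Vec ℕ n → Vec ℕ n
residues []       []      []       = []
residues (q ∷ qs) (d ∷ c) (e ∷ es) = d * q ^ pred e ∷ residues qs c es

-- The valuations of `x` select the exponent vector: `suc j` at each fixed coordinate, where the
-- congruence is the one in `Leading`, and 0 at each free one, where it is vacuous.
exponents-solve : ∀ {x} {Ks qs ds c : Vec ℕ n} → Expansion x Ks qs ds → Matches c ds →
                  Any (λ es → Solves x qs es (residues qs c es)) (exponents Ks c)
exponents-solve []       []        = here []
exponents-solve {x = x} {qs = q ∷ _} (_ ∷ ls) (free m) = AnyP.cartesianProductWith⁺ _ (λ {e} → _∷_ {e = e})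
  (here {P = λ e → + (q ^ e) ∣ℤ x ℤ.- + (0 * q ^ pred e)} {x = 0} {xs = []} (ℤ∣.∣ᵤ⇒∣ (1∣ _))) (exponents-solve ls m)
exponents-solve {x = x} {qs = q ∷ _} {ds = d ∷ _} ((j , j<K , h) ∷ ls) (fixed m) = AnyP.cartesianProductWith⁺ _ _∷_
  (AnyP.applyUpTo⁺ {P = λ e → + (q ^ e) ∣ℤ x ℤ.- + (d * q ^ pred e)} suc h j<K) (exponents-solve ls m)

-- The support as a binary number: one equation of lists then shows that all cubes have different supports.
code : Vec ℕ n → ℕ
code []           = 0
code (zero ∷ ds)  = 2 * code ds
code (suc _ ∷ ds) = suc (2 * code ds)

value-zeros : ∀ (qs : Vec ℕ n) → value qs (replicate n 0) ≡ 1
value-zeros []       = refl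
value-zeros (q ∷ qs) = trans (*-identityˡ _) (value-zeros qs)

code-zeros : ∀ n → code (replicate n 0) ≡ 0
code-zeros zero    = refl
code-zeros (suc n) = cong (2 *_) (code-zeros n)

-- A fixed coordinate always receives a positive exponent and a free one receives 0, so every
-- modulus of a cube has exactly the support of the cube.
code-exponents : ∀ (Ks c : Vec ℕ n) → All (λ es → code es ≡ code c) (exponents Ks c)
code-exponents []       []      = refl ∷ []
code-exponents (K ∷ Ks) (d ∷ c) = AllP.cartesianProductWith⁺ (setoid ℕ) (setoid _) _∷_ _ _
  λ e∈ es∈ → step d e∈ (All.lookup (code-exponents Ks c) es∈)
  where
  step : ∀ d {e es} → e ∈ levels K d → code es ≡ code c → code (e ∷ es) ≡ code (d ∷ c)
  step zero    (here refl) eq = cong (2 *_) eq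
  step (suc _) e∈          eq with ∈-applyUpTo⁻ suc e∈
  ... | _ , _ , refl = cong (λ k → suc (2 * k)) eq

levels-≤ : ∀ K d {e} → e ∈ levels K d → e ≤ K
levels-≤ K zero    (here refl) = z≤n
levels-≤ K (suc _) e∈ with ∈-applyUpTo⁻ suc e∈
... | _ , j<K , refl = j<K

-- Applied with `K = 1` at the prime `p`, this separates the moduli of cubes from those of
-- `deepSystem`, in which `p` has exponent 2.
head-exponents : ∀ K (Ks : Vec ℕ n) c → All (λ es → Vec.head es ≤ K) (exponents (K ∷ Ks) c)
head-exponents K Ks (d ∷ c) = AllP.cartesianProductWith⁺ (setoid ℕ) (setoid _) _∷_ _ _ λ e∈ _ → levels-≤ K d e∈

levels-unique : ∀ K d → Unique (levels K d)
levels-unique K zero    = [] ∷ []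
levels-unique K (suc _) = UniqueP.applyUpTo⁺₁ suc K λ i<j _ → <⇒≢ i<j ∘ suc-injective

exponents-unique : ∀ (Ks c : Vec ℕ n) → Unique (exponents Ks c)
exponents-unique []       []      = [] ∷ []
exponents-unique (K ∷ Ks) (d ∷ c) =
  UniqueP.cartesianProductWith⁺ _∷_ ∷-injective (levels-unique K d) (exponents-unique Ks c)

-- Systems of congruences with distinct exponent vectors

-- Pairs of an exponent vector and a vector of residues modulo the corresponding prime powers.
System : ℕ → Set
System n = List (Vec ℕ n × Vec ℕ n)

Distinct : Vec ℕ n × Vec ℕ n → Vec ℕ n × Vec ℕ n → Set
Distinct a b = proj₁ a ≢ proj₁ b

cubeSystem : Vec ℕ n → Vec ℕ n → List (Vec ℕ n) → System n
cubeSystem Ks qs = concatMap λ c → map (λ es → es , residues qs c es) (exponents Ks c)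

-- Within one cube the enumeration has no repetition; between two cubes the supports differ, because
-- exponent vectors inherit the code of their cube.
cubeSystem-distinct : ∀ (Ks qs : Vec ℕ n) {cs} → Unique (map code cs) → AllPairs Distinct (cubeSystem Ks qs cs)
cubeSystem-distinct Ks qs cs! = AllPairsP.concat⁺
  (AllP.map⁺ (All.universal (λ c → AllPairsP.map⁺ (exponents-unique Ks c)) _))
  (AllPairsP.map⁺ (AllPairs.map (λ {c} {c′} c≢c′ →
    AllP.map⁺ (All.map (λ eq → AllP.map⁺ (All.map (λ eq′ es≡ → c≢c′ (trans (sym eq) (trans (cong code es≡) eq′)))
      (code-exponents Ks c′))) (code-exponents Ks c)))
    (AllPairsP.map⁻ cs!)))

cubeSystem-All : ∀ {P : Vec ℕ n → Set} (Ks qs : Vec ℕ n) {cs} → All (λ c → All P (exponents Ks c)) cs →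
                 All (P ∘ proj₁) (cubeSystem Ks qs cs)
cubeSystem-All Ks qs h = AllP.concat⁺ (AllP.map⁺ (All.map AllP.map⁺ h))

cubeSystem-solve : ∀ {x} {Ks qs ds : Vec ℕ n} {cs} → Expansion x Ks qs ds → Any (λ c → Matches c ds) cs →
                   Any (λ (es , us) → Solves x qs es us) (cubeSystem Ks qs cs)
cubeSystem-solve ls h = AnyP.concat⁺ (AnyP.map⁺ (Any.map (λ m → AnyP.map⁺ (exponents-solve ls m)) h))

-- Integers divisible by a high power of a small prime

single : Fin n → ℕ → Vec ℕ n
single zero    e = e ∷ replicate _ 0
single (suc i) e = 0 ∷ single i e

single-injective : ∀ (i i′ : Fin n) {e e′} → single i (suc e) ≡ single i′ (suc e′) → i ≡ i′ × e ≡ e′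
single-injective zero    zero     refl = refl , refl
single-injective (suc i) (suc i′) eq   =
  let i≡i′ , e≡e′ = single-injective i i′ (proj₂ (∷-injective eq)) in cong suc i≡i′ , e≡e′

code-single : ∀ (i : Fin n) e → 1 ≤ code (single i (suc e))
code-single zero    e = s≤s z≤n
code-single (suc i) e = ≤-trans (code-single i e) (m≤m+n _ _)

-- The class `j` modulo the square of the first prime is paired with the exponent `suc j` at prime
-- `i`, so different classes get different moduli. The residue at prime `i` is 0 because only
-- integers divisible by its `K`-th power have to be caught.
deepSystem : ∀ n → ℕ → System (suc n)
deepSystem n K = concatMap (λ i → applyUpTo (λ j → 2 ∷ single i (suc j) , j ∷ replicate n 0) K) (allFin n)

deepSystem-distinct : ∀ n K → AllPairs Distinct (deepSystem n K)
deepSystem-distinct n K = AllPairsP.concat⁺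
  (AllP.map⁺ (All.universal (λ i → AllPairsP.applyUpTo⁺₁ _ K λ j<j′ _ eq →
    <⇒≢ j<j′ (proj₂ (single-injective i i (proj₂ (∷-injective eq))))) _))
  (AllPairsP.map⁺ (AllPairs.map (λ {i} {i′} i≢i′ → AllP.applyUpTo⁺₂ _ K λ j → AllP.applyUpTo⁺₂ _ K λ j′ eq →
    i≢i′ (proj₁ (single-injective i i′ (proj₂ (∷-injective eq))))) (UniqueP.allFin⁺ n)))

deepSystem-All : ∀ {P : Vec ℕ (suc n) → Set} K → (∀ i j → P (2 ∷ single i (suc j))) → All (P ∘ proj₁) (deepSystem n K)
deepSystem-All K h = AllP.concat⁺ (AllP.map⁺ (All.universal (λ i → AllP.applyUpTo⁺₂ _ K (h i)) (allFin _)))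

solves-zeros : ∀ x (qs : Vec ℕ n) → Solves x qs (replicate _ 0) (replicate _ 0)
solves-zeros x []       = []
solves-zeros x (q ∷ qs) = ℤ∣.∣ᵤ⇒∣ (1∣ _) ∷ solves-zeros x qs

solves-single : ∀ {x} (qs : Vec ℕ n) i {e} → + (lookup qs i ^ e) ∣ℤ x → Solves x qs (single i e) (replicate _ 0)
solves-single {x = x} (q ∷ qs) zero    h = subst (_ ∣ℤ_) (sym (ℤₚ.+-identityʳ x)) h ∷ solves-zeros x qs
solves-single         (q ∷ qs) (suc i) h = ℤ∣.∣ᵤ⇒∣ (1∣ _) ∷ solves-single qs i h

^-∣ : ∀ q {j k} → j ≤ k → q ^ j ∣ q ^ k
^-∣ q {j} {k} j≤k =
  subst (q ^ j ∣_) (trans (sym (^-distribˡ-+-* q j (k ∸ j))) (cong (q ^_) (m+[n∸m]≡n j≤k))) (m∣m*n _)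

-- Take `j` to be the remainder of `x` modulo `p ^ 2`. From `j < p ^ 2` the exponent `suc j` is at
-- most `p ^ 2`, so the required prime power divides `x`.
deepSystem-solve : ∀ {x p} .{{_ : NonZero (p ^ 2)}} (qs : Vec ℕ n) i → + (lookup qs i ^ (p ^ 2)) ∣ℤ x →
                   Any (λ (es , us) → Solves x (p ∷ qs) es us) (deepSystem n (p ^ 2))
deepSystem-solve {x = x} {p} qs i h = AnyP.concat⁺ (AnyP.map⁺ (Any.map (λ { refl →
  AnyP.applyUpTo⁺ _ (remainder-∣ x (p ^ 2) ∷
    solves-single qs i (ℤ∣.∣-trans (ℤ∣.∣ᵤ⇒∣ (^-∣ (lookup qs i) j<p²)) h)) j<p² }) (∈-allFin i)))
  where j<p² = n%ℕd<d x (p ^ 2)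

-- Assembling the covering system from a covering of the grid

-- The codes 0 and 1 are left out because they belong to the moduli 1 and p.
module Assembly
  (p : ℕ) {{p-nonZero : NonZero p}} (qs : Vec ℕ n)
  (1<p : 1 < p) (1<qs : VecAll.All (1 <_) qs)
  (coprimePrimes : VecAllPairs Coprime (p ∷ qs))
  (oddPrimes : VecAll.All (λ q → Coprime q 2) (p ∷ qs))
  (t : ℕ) (cubes : List (Vec ℕ (suc n))) (N : ℕ)
  (cubes-code : map code cubes ≡ applyUpTo (λ k → 2 + k) N)
  (cubes-cover : T (covers (t ∷ Vec.map pred qs) cubes))
  where

  private
    instance
      p²-nonZero : NonZero (p ^ 2)
      p²-nonZero = m^n≢0 p 2

  -- The bound 1 at `p` allows only valuation 0 there: a fixed first coordinate means a class mod
  -- `p`, and `p` enters the modulus to the first power.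
  primes Ks : Vec ℕ (suc n)
  primes = p ∷ qs
  Ks     = 1 ∷ replicate n (p ^ 2)

  1<primes : VecAll.All (1 <_) primes
  1<primes = 1<p ∷ 1<qs

  system : System (suc n)
  system = cubeSystem Ks primes cubes ++ deepSystem n (p ^ 2)

  toCongruence : Vec ℕ (suc n) × Vec ℕ (suc n) → Congruence
  toCongruence (es , us) = value primes es , proj₁ (crt coprimePrimes es us)

  -- The congruences mod `p` take the classes `t + 1` to `p`, so that the classes left to the cubes
  -- are 1 to `t`, numbered like the first grid coordinate.
  multiples rest S : List Congruence
  multiples = applyUpTo (λ k → p , + suc (t + k)) (p ∸ t)
  rest      = map toCongruence system
  S         = multiples ++ rest

  deepHead≢ : ∀ {e} {v : Vec ℕ n} (es : Vec ℕ (suc n)) → Vec.head es ≤ 1 → es ≢ suc (suc e) ∷ v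
  deepHead≢ _ (s≤s ()) refl

  -- Across the two halves the exponent of `p` decides: at most 1 for cubes, and 2 for the deep
  -- congruences.
  system-distinct : AllPairs Distinct system
  system-distinct = AllPairsP.++⁺
    (cubeSystem-distinct Ks primes (subst Unique (sym cubes-code)
      (UniqueP.applyUpTo⁺₁ (λ k → 2 + k) N λ i<j _ → <⇒≢ i<j ∘ +-cancelˡ-≡ 2 _ _)))
    (deepSystem-distinct n (p ^ 2))
    (All.map (λ {(es , _)} h → deepSystem-All (p ^ 2) λ i j → deepHead≢ es h)
      (cubeSystem-All {P = λ es → Vec.head es ≤ 1} Ks primes {cubes}
        (All.universal (λ c → head-exponents 1 _ c) cubes)))

  -- The lowest binary digit of the code belongs to `p`, so a code of at least 2 says that some
  -- prime of `qs` divides the modulus.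
  system-code : All (λ a → 2 ≤ code (proj₁ a)) system
  system-code = AllP.++⁺
    (cubeSystem-All {P = λ es → 2 ≤ code es} Ks primes (All.map (λ {c} h →
       All.map (λ eq → subst (2 ≤_) (sym eq) h) (code-exponents Ks c))
      (AllP.map⁻ (subst (All (2 ≤_)) (sym cubes-code) (AllP.applyUpTo⁺₂ (λ k → 2 + k) N λ i → m≤m+n 2 i)))))
    (deepSystem-All {P = λ es → 2 ≤ code es} (p ^ 2) λ i j → s≤s (≤-trans (code-single i j) (m≤m+n _ _)))

  value≢ : ∀ es fs → 2 ≤ code es → code fs ≤ 1 → value primes es ≢ value primes fs
  value≢ es fs 2≤ ≤1 eq = <⇒≢ (≤-<-trans ≤1 2≤) (sym (cong code (value-injective 1<primes coprimePrimes es fs eq)))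

  value-unit : value primes (1 ∷ replicate n 0) ≡ p
  value-unit = trans (cong (p ^ 1 *_) (value-zeros qs)) (trans (*-identityʳ (p ^ 1)) (*-identityʳ p))

  moduli-rest : moduli rest ≡ map (value primes ∘ proj₁) system
  moduli-rest = sym (map-∘ system)

  -- As an exponent vector `p` is `1 ∷ replicate n 0`, of code 1, while all vectors of `system` have
  -- code at least 2; unique factorization does the rest.
  rest≢p : All (_≢ p) (moduli rest)
  rest≢p = subst (All (_≢ p)) (sym moduli-rest) (AllP.map⁺ (All.map
    (λ {(es , _)} h eq → value≢ es (1 ∷ replicate n 0) h (s≤s (≤-reflexive (cong (2 *_) (code-zeros n))))
        (trans eq (sym value-unit))) system-code))

  rest-unique : Unique (moduli rest)
  rest-unique = subst Unique (sym moduli-rest) (AllPairsP.map⁺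
    (AllPairs.map (λ {(es , _)} {(fs , _)} es≢fs eq → es≢fs (value-injective 1<primes coprimePrimes es fs eq))
        system-distinct))

  multiples≡p : All (_≡ p) (moduli multiples)
  multiples≡p = AllP.map⁺ (AllP.applyUpTo⁺₂ _ (p ∸ t) λ _ → refl)

  moduli-S : moduli S ≡ moduli multiples ++ moduli rest
  moduli-S = map-++ proj₁ multiples rest

  count : countModulus p S ≡ p ∸ t
  count = begin
    length (filter (ℕ._≟ p) (moduli S))
      ≡⟨ cong (length ∘ filter (ℕ._≟ p)) moduli-S ⟩
    length (filter (ℕ._≟ p) (moduli multiples ++ moduli rest))
      ≡⟨ cong length (filter-++ (ℕ._≟ p) (moduli multiples) (moduli rest)) ⟩
    length (filter (ℕ._≟ p) (moduli multiples) ++ filter (ℕ._≟ p) (moduli rest))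
      ≡⟨ cong₂ (λ xs ys → length (xs ++ ys)) (filter-all (ℕ._≟ p) multiples≡p) (filter-none (ℕ._≟ p) rest≢p) ⟩
    length (moduli multiples ++ [])
      ≡⟨ cong length (++-identityʳ (moduli multiples)) ⟩
    length (moduli multiples)
      ≡⟨ length-map proj₁ multiples ⟩
    length multiples
      ≡⟨ length-applyUpTo _ (p ∸ t) ⟩
    p ∸ t ∎
    where open ≡-Reasoning

  uniqueModuli : Unique (otherModuli p S)
  uniqueModuli = subst Unique (sym others) rest-unique
    where
    ≢p? = λ m → ¬? (m ℕ.≟ p)
    others : otherModuli p S ≡ moduli rest
    others = trans (cong (filter ≢p?) moduli-S) (trans (filter-++ ≢p? (moduli multiples) (moduli rest))
      (cong₂ _++_ (filter-none ≢p? (All.map (λ m≡p m≢p → m≢p m≡p) multiples≡p)) (filter-all ≢p? rest≢p)))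

  odd : ∀ {m} → Coprime m 2 → Odd m
  odd c 2∣m = contradiction (c (2∣m , ∣-refl)) λ ()

  -- The modulus is positive, and it is not 1 because 1 belongs to the zero vector, of code 0.
  1<value : ∀ es → 2 ≤ code es → 1 < value primes es
  1<value es h = ≤∧≢⇒< (ℕ.>-nonZero⁻¹ _ {{value-nonZero 1<primes es}})
    λ eq → value≢ es (replicate (suc n) 0) h (≤-trans (≤-reflexive (code-zeros (suc n))) z≤n)
      (trans (sym eq) (sym (value-zeros primes)))

  oddModuli : All (λ m → Odd m × 1 < m) (moduli S)
  oddModuli = subst (All _) (sym moduli-S) (AllP.++⁺
    (All.map (λ { refl → odd (VecAll.head oddPrimes) , 1<p }) multiples≡p)
    (subst (All _) (sym moduli-rest) (AllP.map⁺
      (All.map (λ {(es , _)} h → odd (coprime-value oddPrimes es) , 1<value es h) system-code))))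

  toSatisfies : ∀ x → Any (λ (es , us) → Solves x primes es us) system → Any (Satisfies x) S
  toSatisfies x h = AnyP.++⁺ʳ multiples (AnyP.map⁺ (Any.map
    (λ {(es , us)} s → ℤ∣.∣⇒∣ᵤ (proj₂ (crt coprimePrimes es us) x s)) h))

  covering : IsCovering S
  -- Reducing `x - 1` instead of `x` numbers the classes mod `p` from 1 to `p`: `x ≡ suc r`.
  covering x with (x ℤ.- + 1) %ℕ p | n%ℕd<d (x ℤ.- + 1) p | remainder-∣ (x ℤ.- + 1) p
  ... | r | r<p | h = case r ℕ.<? t of λ where
      -- Entry `k = r ∸ t` of `multiples` has residue `suc (t + k) = suc r`.
      (no r≮t) → AnyP.++⁺ˡ (AnyP.applyUpTo⁺ _ {i = r ∸ t}
        (subst (λ k → p ∣ ℤ.∣ x ℤ.- + k ∣) (cong suc (sym (m+[n∸m]≡n (≮⇒≥ r≮t)))) (ℤ∣.∣⇒∣ᵤ h′))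
        (∸-monoˡ-< r<p (≮⇒≥ r≮t)))
      (yes r<t) → toSatisfies x (case expansion 1<qs (p ^ 2) x of λ where
        (inj₁ (i , deep)) → AnyP.++⁺ʳ (cubeSystem Ks primes cubes) (deepSystem-solve qs i deep)
        (inj₂ (ds , ds∈ , ls)) → AnyP.++⁺ˡ (cubeSystem-solve {Ks = Ks} {primes} {suc r ∷ ds}
          -- The entry for `p` has valuation 0 and digit `suc r`; the rewriting removes the factors
          -- 1 from `p ^ 1` and `suc r * p ^ 0`.
          ((0 , s≤s z≤n , subst₂ (λ k u → + k ∣ℤ x ℤ.- + u) (sym (*-identityʳ p)) (sym (*-identityʳ (suc r))) h′) ∷ ls)
          (covers-sound _ cubes cubes-cover (∈-applyUpTo⁺ suc r<t ∷ ds∈))))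
    where
    h′ : + p ∣ℤ x ℤ.- + suc r
    h′ = subst (+ p ∣ℤ_) (shift x (+ r)) h
      where
      shift : ∀ x r → x ℤ.- + 1 ℤ.- r ≡ x ℤ.- (+ 1 ℤ.+ r)
      shift = solve-∀

-- The seven small primes and the explicit covering of the grid

smallPrimes : Vec ℕ 7
smallPrimes = 3 ∷ 5 ∷ 7 ∷ 11 ∷ 13 ∷ 17 ∷ 19 ∷ []

1<smallPrimes : VecAll.All (1 <_) smallPrimes
1<smallPrimes = toWitness {a? = VecAll.all? (1 ℕ.<?_) smallPrimes} tt

-- A prime is coprime to every smaller positive integer, so these bounds and `23 ≤ p` make `p`
-- coprime to each small prime.
smallPrimes-range : VecAll.All (λ q → 0 < q × q < 23) smallPrimes
smallPrimes-range = toWitness {a? = VecAll.all? (λ q → 0 ℕ.<? q ×-dec q ℕ.<? 23) smallPrimes} tt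

smallPrimes-odd : VecAll.All (λ q → Coprime q 2) smallPrimes
smallPrimes-odd = toWitness {a? = VecAll.all? (λ q → coprime? q 2) smallPrimes} tt

smallPrimes-coprime : VecAllPairs Coprime smallPrimes
smallPrimes-coprime = toWitness {a? = allPairs? coprime? smallPrimes} tt

-- Found by computer search; ordered by code.  The first coordinate is the class mod p.
cubes : List (Vec ℕ 8)
cubes =
    ( 0 ∷  1 ∷  0 ∷  0 ∷  0 ∷  0 ∷  0 ∷  0 ∷ [])
  ∷ ( 5 ∷  2 ∷  0 ∷  0 ∷  0 ∷  0 ∷  0 ∷  0 ∷ [])
  ∷ ( 0 ∷  0 ∷  2 ∷  0 ∷  0 ∷  0 ∷  0 ∷  0 ∷ [])
  ∷ ( 2 ∷  0 ∷  4 ∷  0 ∷  0 ∷  0 ∷  0 ∷  0 ∷ [])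
  ∷ ( 0 ∷  2 ∷  1 ∷  0 ∷  0 ∷  0 ∷  0 ∷  0 ∷ [])
  ∷ ( 1 ∷  2 ∷  4 ∷  0 ∷  0 ∷  0 ∷  0 ∷  0 ∷ [])
  ∷ ( 0 ∷  0 ∷  0 ∷  6 ∷  0 ∷  0 ∷  0 ∷  0 ∷ [])
  ∷ ( 3 ∷  0 ∷  0 ∷  3 ∷  0 ∷  0 ∷  0 ∷  0 ∷ [])
  ∷ ( 0 ∷  2 ∷  0 ∷  4 ∷  0 ∷  0 ∷  0 ∷  0 ∷ [])
  ∷ ( 3 ∷  2 ∷  0 ∷  5 ∷  0 ∷  0 ∷  0 ∷  0 ∷ [])
  ∷ ( 0 ∷  0 ∷  3 ∷  1 ∷  0 ∷  0 ∷  0 ∷  0 ∷ [])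
  ∷ ( 3 ∷  0 ∷  4 ∷  1 ∷  0 ∷  0 ∷  0 ∷  0 ∷ [])
  ∷ ( 0 ∷  2 ∷  3 ∷  2 ∷  0 ∷  0 ∷  0 ∷  0 ∷ [])
  ∷ ( 3 ∷  2 ∷  4 ∷  2 ∷  0 ∷  0 ∷  0 ∷  0 ∷ [])
  ∷ ( 0 ∷  0 ∷  0 ∷  0 ∷  8 ∷  0 ∷  0 ∷  0 ∷ [])
  ∷ ( 4 ∷  0 ∷  0 ∷  0 ∷  2 ∷  0 ∷  0 ∷  0 ∷ [])
  ∷ ( 0 ∷  2 ∷  0 ∷  0 ∷  1 ∷  0 ∷  0 ∷  0 ∷ [])
  ∷ ( 4 ∷  2 ∷  0 ∷  0 ∷  6 ∷  0 ∷  0 ∷  0 ∷ [])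
  ∷ ( 0 ∷  0 ∷  4 ∷  0 ∷  5 ∷  0 ∷  0 ∷  0 ∷ [])
  ∷ ( 4 ∷  0 ∷  4 ∷  0 ∷  4 ∷  0 ∷  0 ∷  0 ∷ [])
  ∷ ( 0 ∷  2 ∷  4 ∷  0 ∷ 10 ∷  0 ∷  0 ∷  0 ∷ [])
  ∷ ( 4 ∷  2 ∷  4 ∷  0 ∷  3 ∷  0 ∷  0 ∷  0 ∷ [])
  ∷ ( 0 ∷  0 ∷  0 ∷  5 ∷  7 ∷  0 ∷  0 ∷  0 ∷ [])
  ∷ ( 4 ∷  0 ∷  0 ∷  2 ∷  9 ∷  0 ∷  0 ∷  0 ∷ [])
  ∷ ( 0 ∷  2 ∷  0 ∷  3 ∷  7 ∷  0 ∷  0 ∷  0 ∷ [])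
  ∷ ( 1 ∷  2 ∷  0 ∷  3 ∷  3 ∷  0 ∷  0 ∷  0 ∷ [])
  ∷ ( 0 ∷  0 ∷  3 ∷  3 ∷  2 ∷  0 ∷  0 ∷  0 ∷ [])
  ∷ ( 4 ∷  0 ∷  4 ∷  1 ∷  7 ∷  0 ∷  0 ∷  0 ∷ [])
  ∷ ( 0 ∷  2 ∷  3 ∷  3 ∷  6 ∷  0 ∷  0 ∷  0 ∷ [])
  ∷ ( 4 ∷  2 ∷  4 ∷  2 ∷  7 ∷  0 ∷  0 ∷  0 ∷ [])
  ∷ ( 0 ∷  0 ∷  0 ∷  0 ∷  0 ∷  9 ∷  0 ∷  0 ∷ [])
  ∷ ( 4 ∷  0 ∷  0 ∷  0 ∷  0 ∷ 10 ∷  0 ∷  0 ∷ [])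
  ∷ ( 0 ∷  2 ∷  0 ∷  0 ∷  0 ∷  7 ∷  0 ∷  0 ∷ [])
  ∷ ( 4 ∷  2 ∷  0 ∷  0 ∷  0 ∷ 11 ∷  0 ∷  0 ∷ [])
  ∷ ( 0 ∷  0 ∷  3 ∷  0 ∷  0 ∷  5 ∷  0 ∷  0 ∷ [])
  ∷ ( 2 ∷  0 ∷  3 ∷  0 ∷  0 ∷ 10 ∷  0 ∷  0 ∷ [])
  ∷ ( 0 ∷  2 ∷  3 ∷  0 ∷  0 ∷ 12 ∷  0 ∷  0 ∷ [])
  ∷ ( 2 ∷  2 ∷  3 ∷  0 ∷  0 ∷  6 ∷  0 ∷  0 ∷ [])
  ∷ ( 0 ∷  0 ∷  0 ∷  5 ∷  0 ∷  2 ∷  0 ∷  0 ∷ [])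
  ∷ ( 1 ∷  0 ∷  0 ∷  5 ∷  0 ∷ 11 ∷  0 ∷  0 ∷ [])
  ∷ ( 0 ∷  2 ∷  0 ∷  5 ∷  0 ∷  1 ∷  0 ∷  0 ∷ [])
  ∷ ( 1 ∷  2 ∷  0 ∷  5 ∷  0 ∷  6 ∷  0 ∷  0 ∷ [])
  ∷ ( 0 ∷  0 ∷  3 ∷  5 ∷  0 ∷  8 ∷  0 ∷  0 ∷ [])
  ∷ ( 1 ∷  0 ∷  3 ∷  5 ∷  0 ∷ 10 ∷  0 ∷  0 ∷ [])
  ∷ ( 0 ∷  2 ∷  3 ∷  5 ∷  0 ∷  3 ∷  0 ∷  0 ∷ [])
  ∷ ( 2 ∷  2 ∷  3 ∷  5 ∷  0 ∷ 11 ∷  0 ∷  0 ∷ [])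
  ∷ ( 0 ∷  0 ∷  0 ∷  0 ∷  5 ∷  4 ∷  0 ∷  0 ∷ [])
  ∷ ( 4 ∷  0 ∷  0 ∷  0 ∷  9 ∷  6 ∷  0 ∷  0 ∷ [])
  ∷ ( 0 ∷  2 ∷  0 ∷  0 ∷  9 ∷  4 ∷  0 ∷  0 ∷ [])
  ∷ ( 4 ∷  2 ∷  0 ∷  0 ∷  9 ∷  3 ∷  0 ∷  0 ∷ [])
  ∷ ( 0 ∷  0 ∷  3 ∷  0 ∷ 10 ∷  4 ∷  0 ∷  0 ∷ [])
  ∷ ( 4 ∷  0 ∷  4 ∷  0 ∷  9 ∷ 12 ∷  0 ∷  0 ∷ [])
  ∷ ( 0 ∷  2 ∷  3 ∷  0 ∷  4 ∷  4 ∷  0 ∷  0 ∷ [])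
  ∷ ( 4 ∷  2 ∷  4 ∷  0 ∷  9 ∷  5 ∷  0 ∷  0 ∷ [])
  ∷ ( 0 ∷  0 ∷  0 ∷  3 ∷  9 ∷  1 ∷  0 ∷  0 ∷ [])
  ∷ ( 4 ∷  0 ∷  0 ∷  3 ∷  5 ∷  6 ∷  0 ∷  0 ∷ [])
  ∷ ( 0 ∷  2 ∷  0 ∷  3 ∷  9 ∷  2 ∷  0 ∷  0 ∷ [])
  ∷ ( 4 ∷  2 ∷  0 ∷  3 ∷  9 ∷  8 ∷  0 ∷  0 ∷ [])
  ∷ ( 0 ∷  0 ∷  3 ∷  3 ∷  5 ∷  8 ∷  0 ∷  0 ∷ [])
  ∷ ( 4 ∷  0 ∷  3 ∷  3 ∷  5 ∷  1 ∷  0 ∷  0 ∷ [])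
  ∷ ( 0 ∷  2 ∷  3 ∷  3 ∷  5 ∷  2 ∷  0 ∷  0 ∷ [])
  ∷ ( 4 ∷  2 ∷  3 ∷  5 ∷ 10 ∷  6 ∷  0 ∷  0 ∷ [])
  ∷ ( 0 ∷  0 ∷  0 ∷  0 ∷  0 ∷  0 ∷ 15 ∷  0 ∷ [])
  ∷ ( 4 ∷  0 ∷  0 ∷  0 ∷  0 ∷  0 ∷  7 ∷  0 ∷ [])
  ∷ ( 0 ∷  2 ∷  0 ∷  0 ∷  0 ∷  0 ∷  5 ∷  0 ∷ [])
  ∷ ( 1 ∷  2 ∷  0 ∷  0 ∷  0 ∷  0 ∷ 14 ∷  0 ∷ [])
  ∷ ( 0 ∷  0 ∷  3 ∷  0 ∷  0 ∷  0 ∷  9 ∷  0 ∷ [])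
  ∷ ( 4 ∷  0 ∷  3 ∷  0 ∷  0 ∷  0 ∷  2 ∷  0 ∷ [])
  ∷ ( 0 ∷  2 ∷  3 ∷  0 ∷  0 ∷  0 ∷  6 ∷  0 ∷ [])
  ∷ ( 1 ∷  2 ∷  3 ∷  0 ∷  0 ∷  0 ∷  7 ∷  0 ∷ [])
  ∷ ( 0 ∷  0 ∷  0 ∷  3 ∷  0 ∷  0 ∷ 16 ∷  0 ∷ [])
  ∷ ( 2 ∷  0 ∷  0 ∷  3 ∷  0 ∷  0 ∷ 14 ∷  0 ∷ [])
  ∷ ( 0 ∷  2 ∷  0 ∷  3 ∷  0 ∷  0 ∷  3 ∷  0 ∷ [])
  ∷ ( 1 ∷  2 ∷  0 ∷  3 ∷  0 ∷  0 ∷  2 ∷  0 ∷ [])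
  ∷ ( 0 ∷  0 ∷  3 ∷  3 ∷  0 ∷  0 ∷ 11 ∷  0 ∷ [])
  ∷ ( 2 ∷  0 ∷  3 ∷  3 ∷  0 ∷  0 ∷  7 ∷  0 ∷ [])
  ∷ ( 0 ∷  2 ∷  3 ∷  3 ∷  0 ∷  0 ∷ 13 ∷  0 ∷ [])
  ∷ ( 2 ∷  2 ∷  3 ∷  3 ∷  0 ∷  0 ∷  2 ∷  0 ∷ [])
  ∷ ( 0 ∷  0 ∷  0 ∷  0 ∷  4 ∷  0 ∷ 12 ∷  0 ∷ [])
  ∷ ( 4 ∷  0 ∷  0 ∷  0 ∷  4 ∷  0 ∷ 14 ∷  0 ∷ [])
  ∷ ( 0 ∷  2 ∷  0 ∷  0 ∷  3 ∷  0 ∷ 12 ∷  0 ∷ [])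
  ∷ ( 2 ∷  2 ∷  0 ∷  0 ∷  3 ∷  0 ∷ 10 ∷  0 ∷ [])
  ∷ ( 0 ∷  0 ∷  3 ∷  0 ∷  3 ∷  0 ∷  8 ∷  0 ∷ [])
  ∷ ( 4 ∷  0 ∷  3 ∷  0 ∷  3 ∷  0 ∷ 10 ∷  0 ∷ [])
  ∷ ( 0 ∷  2 ∷  3 ∷  0 ∷  4 ∷  0 ∷ 10 ∷  0 ∷ [])
  ∷ ( 4 ∷  2 ∷  3 ∷  0 ∷  3 ∷  0 ∷ 14 ∷  0 ∷ [])
  ∷ ( 0 ∷  0 ∷  0 ∷  3 ∷ 10 ∷  0 ∷ 12 ∷  0 ∷ [])
  ∷ ( 1 ∷  0 ∷  0 ∷  3 ∷  9 ∷  0 ∷ 12 ∷  0 ∷ [])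
  ∷ ( 0 ∷  2 ∷  0 ∷  3 ∷ 10 ∷  0 ∷ 10 ∷  0 ∷ [])
  ∷ ( 1 ∷  2 ∷  0 ∷  3 ∷  5 ∷  0 ∷ 12 ∷  0 ∷ [])
  ∷ ( 0 ∷  0 ∷  3 ∷  3 ∷ 10 ∷  0 ∷  8 ∷  0 ∷ [])
  ∷ ( 1 ∷  0 ∷  3 ∷  3 ∷  9 ∷  0 ∷ 10 ∷  0 ∷ [])
  ∷ ( 0 ∷  2 ∷  3 ∷  3 ∷  4 ∷  0 ∷  8 ∷  0 ∷ [])
  ∷ ( 4 ∷  2 ∷  3 ∷  3 ∷ 10 ∷  0 ∷ 14 ∷  0 ∷ [])
  ∷ ( 0 ∷  0 ∷  0 ∷  0 ∷  0 ∷  8 ∷  1 ∷  0 ∷ [])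
  ∷ ( 2 ∷  0 ∷  0 ∷  0 ∷  0 ∷ 11 ∷  4 ∷  0 ∷ [])
  ∷ ( 0 ∷  2 ∷  0 ∷  0 ∷  0 ∷  8 ∷  4 ∷  0 ∷ [])
  ∷ ( 4 ∷  2 ∷  0 ∷  0 ∷  0 ∷  6 ∷  1 ∷  0 ∷ [])
  ∷ ( 0 ∷  0 ∷  3 ∷  0 ∷  0 ∷  1 ∷  1 ∷  0 ∷ [])
  ∷ ( 1 ∷  0 ∷  3 ∷  0 ∷  0 ∷ 10 ∷  1 ∷  0 ∷ [])
  ∷ ( 0 ∷  2 ∷  3 ∷  0 ∷  0 ∷  3 ∷  4 ∷  0 ∷ [])
  ∷ ( 4 ∷  2 ∷  3 ∷  0 ∷  0 ∷  6 ∷  4 ∷  0 ∷ [])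
  ∷ ( 0 ∷  0 ∷  0 ∷  3 ∷  0 ∷  2 ∷  4 ∷  0 ∷ [])
  ∷ ( 1 ∷  0 ∷  0 ∷  3 ∷  0 ∷ 10 ∷  4 ∷  0 ∷ [])
  ∷ ( 0 ∷  2 ∷  0 ∷  3 ∷  0 ∷  3 ∷  1 ∷  0 ∷ [])
  ∷ ( 1 ∷  2 ∷  0 ∷  3 ∷  0 ∷  6 ∷  1 ∷  0 ∷ [])
  ∷ ( 0 ∷  0 ∷  3 ∷  3 ∷  0 ∷  2 ∷  1 ∷  0 ∷ [])
  ∷ ( 1 ∷  0 ∷  3 ∷  3 ∷  0 ∷  6 ∷  4 ∷  0 ∷ [])
  ∷ ( 0 ∷  2 ∷  3 ∷  3 ∷  0 ∷  1 ∷  4 ∷  0 ∷ [])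
  ∷ ( 1 ∷  2 ∷  3 ∷  3 ∷  0 ∷ 11 ∷  4 ∷  0 ∷ [])
  ∷ ( 0 ∷  0 ∷  0 ∷  0 ∷  3 ∷  4 ∷ 14 ∷  0 ∷ [])
  ∷ ( 4 ∷  0 ∷  0 ∷  0 ∷  9 ∷  8 ∷ 11 ∷  0 ∷ [])
  ∷ ( 0 ∷  2 ∷  0 ∷  0 ∷  5 ∷  3 ∷ 12 ∷  0 ∷ [])
  ∷ ( 1 ∷  2 ∷  0 ∷  0 ∷  2 ∷  4 ∷  1 ∷  0 ∷ [])
  ∷ ( 0 ∷  0 ∷  3 ∷  0 ∷  3 ∷  4 ∷  1 ∷  0 ∷ [])
  ∷ ( 4 ∷  0 ∷  4 ∷  0 ∷  9 ∷  8 ∷ 13 ∷  0 ∷ [])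
  ∷ ( 0 ∷  2 ∷  3 ∷  0 ∷  3 ∷  4 ∷  4 ∷  0 ∷ [])
  ∷ ( 4 ∷  2 ∷  3 ∷  0 ∷  4 ∷  6 ∷ 16 ∷  0 ∷ [])
  ∷ ( 0 ∷  0 ∷  0 ∷  5 ∷  6 ∷  4 ∷  8 ∷  0 ∷ [])
  ∷ ( 2 ∷  0 ∷  0 ∷  3 ∷  4 ∷ 11 ∷  1 ∷  0 ∷ [])
  ∷ ( 0 ∷  2 ∷  0 ∷  5 ∷  5 ∷  6 ∷  8 ∷  0 ∷ [])
  ∷ ( 1 ∷  2 ∷  0 ∷  5 ∷  2 ∷  4 ∷ 10 ∷  0 ∷ [])
  ∷ ( 0 ∷  0 ∷  3 ∷  5 ∷  5 ∷  6 ∷ 11 ∷  0 ∷ [])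
  ∷ ( 4 ∷  0 ∷  4 ∷  1 ∷  9 ∷  2 ∷  3 ∷  0 ∷ [])
  ∷ ( 0 ∷  2 ∷  3 ∷  5 ∷  3 ∷  4 ∷ 16 ∷  0 ∷ [])
  ∷ ( 2 ∷  2 ∷  3 ∷  3 ∷  9 ∷  8 ∷ 10 ∷  0 ∷ [])
  ∷ ( 0 ∷  0 ∷  0 ∷  0 ∷  0 ∷  0 ∷  0 ∷  2 ∷ [])
  ∷ ( 4 ∷  0 ∷  0 ∷  0 ∷  0 ∷  0 ∷  0 ∷ 10 ∷ [])
  ∷ ( 0 ∷  2 ∷  0 ∷  0 ∷  0 ∷  0 ∷  0 ∷  1 ∷ [])
  ∷ ( 4 ∷  2 ∷  0 ∷  0 ∷  0 ∷  0 ∷  0 ∷  9 ∷ [])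
  ∷ ( 0 ∷  0 ∷  3 ∷  0 ∷  0 ∷  0 ∷  0 ∷  4 ∷ [])
  ∷ ( 2 ∷  0 ∷  3 ∷  0 ∷  0 ∷  0 ∷  0 ∷ 10 ∷ [])
  ∷ ( 0 ∷  2 ∷  3 ∷  0 ∷  0 ∷  0 ∷  0 ∷  3 ∷ [])
  ∷ ( 2 ∷  2 ∷  3 ∷  0 ∷  0 ∷  0 ∷  0 ∷  9 ∷ [])
  ∷ ( 0 ∷  0 ∷  0 ∷  5 ∷  0 ∷  0 ∷  0 ∷  6 ∷ [])
  ∷ ( 4 ∷  0 ∷  0 ∷  1 ∷  0 ∷  0 ∷  0 ∷ 18 ∷ [])
  ∷ ( 0 ∷  2 ∷  0 ∷  5 ∷  0 ∷  0 ∷  0 ∷  5 ∷ [])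
  ∷ ( 4 ∷  2 ∷  0 ∷  1 ∷  0 ∷  0 ∷  0 ∷  6 ∷ [])
  ∷ ( 0 ∷  0 ∷  3 ∷  5 ∷  0 ∷  0 ∷  0 ∷  8 ∷ [])
  ∷ ( 2 ∷  0 ∷  3 ∷  3 ∷  0 ∷  0 ∷  0 ∷ 12 ∷ [])
  ∷ ( 0 ∷  2 ∷  3 ∷  5 ∷  0 ∷  0 ∷  0 ∷  7 ∷ [])
  ∷ ( 2 ∷  2 ∷  3 ∷  3 ∷  0 ∷  0 ∷  0 ∷ 15 ∷ [])
  ∷ ( 0 ∷  0 ∷  0 ∷  0 ∷  9 ∷  0 ∷  0 ∷  8 ∷ [])
  ∷ ( 4 ∷  0 ∷  0 ∷  0 ∷  9 ∷  0 ∷  0 ∷ 11 ∷ [])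
  ∷ ( 0 ∷  2 ∷  0 ∷  0 ∷  9 ∷  0 ∷  0 ∷  7 ∷ [])
  ∷ ( 4 ∷  2 ∷  0 ∷  0 ∷  9 ∷  0 ∷  0 ∷  3 ∷ [])
  ∷ ( 0 ∷  0 ∷  4 ∷  0 ∷  9 ∷  0 ∷  0 ∷ 14 ∷ [])
  ∷ ( 4 ∷  0 ∷  4 ∷  0 ∷  9 ∷  0 ∷  0 ∷ 13 ∷ [])
  ∷ ( 0 ∷  2 ∷  4 ∷  0 ∷  9 ∷  0 ∷  0 ∷  4 ∷ [])
  ∷ ( 4 ∷  2 ∷  4 ∷  0 ∷  9 ∷  0 ∷  0 ∷ 12 ∷ [])
  ∷ ( 0 ∷  0 ∷  0 ∷  3 ∷  5 ∷  0 ∷  0 ∷  7 ∷ [])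
  ∷ ( 4 ∷  0 ∷  0 ∷  1 ∷  9 ∷  0 ∷  0 ∷ 16 ∷ [])
  ∷ ( 0 ∷  2 ∷  0 ∷  3 ∷  5 ∷  0 ∷  0 ∷  6 ∷ [])
  ∷ ( 4 ∷  2 ∷  0 ∷  1 ∷  9 ∷  0 ∷  0 ∷ 15 ∷ [])
  ∷ ( 0 ∷  0 ∷  3 ∷  3 ∷  5 ∷  0 ∷  0 ∷  5 ∷ [])
  ∷ ( 2 ∷  0 ∷  3 ∷  3 ∷  9 ∷  0 ∷  0 ∷  5 ∷ [])
  ∷ ( 0 ∷  2 ∷  4 ∷  1 ∷  9 ∷  0 ∷  0 ∷  5 ∷ [])
  ∷ ( 4 ∷  2 ∷  4 ∷  1 ∷  9 ∷  0 ∷  0 ∷ 17 ∷ [])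
  ∷ ( 0 ∷  0 ∷  0 ∷  0 ∷  0 ∷  4 ∷  0 ∷ 16 ∷ [])
  ∷ ( 4 ∷  0 ∷  0 ∷  0 ∷  0 ∷  6 ∷  0 ∷ 14 ∷ [])
  ∷ ( 0 ∷  2 ∷  0 ∷  0 ∷  0 ∷  4 ∷  0 ∷ 12 ∷ [])
  ∷ ( 4 ∷  2 ∷  0 ∷  0 ∷  0 ∷  6 ∷  0 ∷ 18 ∷ [])
  ∷ ( 0 ∷  0 ∷  3 ∷  0 ∷  0 ∷  4 ∷  0 ∷ 14 ∷ [])
  ∷ ( 4 ∷  0 ∷  3 ∷  0 ∷  0 ∷  6 ∷  0 ∷ 11 ∷ [])
  ∷ ( 0 ∷  2 ∷  3 ∷  0 ∷  0 ∷  4 ∷  0 ∷ 11 ∷ [])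
  ∷ ( 1 ∷  2 ∷  3 ∷  0 ∷  0 ∷  4 ∷  0 ∷  9 ∷ [])
  ∷ ( 0 ∷  0 ∷  0 ∷  5 ∷  0 ∷  4 ∷  0 ∷ 15 ∷ [])
  ∷ ( 4 ∷  0 ∷  0 ∷  5 ∷  0 ∷  6 ∷  0 ∷ 17 ∷ [])
  ∷ ( 0 ∷  2 ∷  0 ∷  5 ∷  0 ∷  4 ∷  0 ∷ 13 ∷ [])
  ∷ ( 4 ∷  2 ∷  0 ∷  5 ∷  0 ∷  6 ∷  0 ∷ 12 ∷ [])
  ∷ ( 0 ∷  0 ∷  3 ∷  5 ∷  0 ∷  4 ∷  0 ∷ 18 ∷ [])
  ∷ ( 4 ∷  0 ∷  3 ∷  5 ∷  0 ∷  6 ∷  0 ∷ 13 ∷ [])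
  ∷ ( 0 ∷  2 ∷  3 ∷  5 ∷  0 ∷  4 ∷  0 ∷ 17 ∷ [])
  ∷ ( 1 ∷  2 ∷  3 ∷  5 ∷  0 ∷  4 ∷  0 ∷ 10 ∷ [])
  ∷ ( 0 ∷  0 ∷  0 ∷  0 ∷  9 ∷  8 ∷  0 ∷ 18 ∷ [])
  ∷ ( 2 ∷  0 ∷  0 ∷  0 ∷  9 ∷ 11 ∷  0 ∷  6 ∷ [])
  ∷ ( 0 ∷  2 ∷  0 ∷  0 ∷  9 ∷  8 ∷  0 ∷ 16 ∷ [])
  ∷ ( 4 ∷  2 ∷  0 ∷  0 ∷  9 ∷  8 ∷  0 ∷ 15 ∷ [])
  ∷ ( 0 ∷  0 ∷  3 ∷  0 ∷  3 ∷  6 ∷  0 ∷ 15 ∷ [])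
  ∷ ( 4 ∷  0 ∷  3 ∷  0 ∷  5 ∷  3 ∷  0 ∷ 12 ∷ [])
  ∷ ( 0 ∷  2 ∷  3 ∷  0 ∷  9 ∷  8 ∷  0 ∷  6 ∷ [])
  ∷ ( 2 ∷  2 ∷  3 ∷  0 ∷  9 ∷  3 ∷  0 ∷  6 ∷ [])
  ∷ ( 0 ∷  0 ∷  0 ∷  5 ∷  4 ∷  6 ∷  0 ∷ 16 ∷ [])
  ∷ ( 4 ∷  0 ∷  0 ∷  5 ∷  5 ∷  6 ∷  0 ∷ 16 ∷ [])
  ∷ ( 0 ∷  2 ∷  0 ∷  5 ∷  4 ∷  6 ∷  0 ∷ 15 ∷ [])
  ∷ ( 4 ∷  2 ∷  0 ∷  5 ∷  5 ∷  6 ∷  0 ∷ 15 ∷ [])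
  ∷ ( 0 ∷  0 ∷  4 ∷  5 ∷  9 ∷  8 ∷  0 ∷ 17 ∷ [])
  ∷ ( 4 ∷  0 ∷  3 ∷  5 ∷  3 ∷  6 ∷  0 ∷ 16 ∷ [])
  ∷ ( 0 ∷  2 ∷  3 ∷  3 ∷  9 ∷  3 ∷  0 ∷ 14 ∷ [])
  ∷ ( 4 ∷  2 ∷  3 ∷  3 ∷  5 ∷  3 ∷  0 ∷ 15 ∷ [])
  ∷ ( 0 ∷  0 ∷  0 ∷  0 ∷  0 ∷  0 ∷  8 ∷ 16 ∷ [])
  ∷ ( 2 ∷  0 ∷  0 ∷  0 ∷  0 ∷  0 ∷ 12 ∷ 16 ∷ [])
  ∷ ( 0 ∷  2 ∷  0 ∷  0 ∷  0 ∷  0 ∷  8 ∷ 15 ∷ [])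
  ∷ ( 2 ∷  2 ∷  0 ∷  0 ∷  0 ∷  0 ∷ 12 ∷ 11 ∷ [])
  ∷ ( 0 ∷  0 ∷  3 ∷  0 ∷  0 ∷  0 ∷  8 ∷ 14 ∷ [])
  ∷ ( 2 ∷  0 ∷  3 ∷  0 ∷  0 ∷  0 ∷ 12 ∷ 17 ∷ [])
  ∷ ( 0 ∷  2 ∷  3 ∷  0 ∷  0 ∷  0 ∷  8 ∷ 13 ∷ [])
  ∷ ( 1 ∷  2 ∷  3 ∷  0 ∷  0 ∷  0 ∷  8 ∷ 10 ∷ [])
  ∷ ( 0 ∷  0 ∷  0 ∷  3 ∷  0 ∷  0 ∷  8 ∷ 12 ∷ [])
  ∷ ( 2 ∷  0 ∷  0 ∷  3 ∷  0 ∷  0 ∷ 12 ∷ 14 ∷ [])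
  ∷ ( 0 ∷  2 ∷  0 ∷  3 ∷  0 ∷  0 ∷  8 ∷ 11 ∷ [])
  ∷ ( 1 ∷  2 ∷  0 ∷  3 ∷  0 ∷  0 ∷  8 ∷  9 ∷ [])
  ∷ ( 0 ∷  0 ∷  3 ∷  3 ∷  0 ∷  0 ∷  8 ∷ 18 ∷ [])
  ∷ ( 2 ∷  0 ∷  3 ∷  3 ∷  0 ∷  0 ∷ 12 ∷ 13 ∷ [])
  ∷ ( 0 ∷  2 ∷  3 ∷  3 ∷  0 ∷  0 ∷  8 ∷ 17 ∷ [])
  ∷ ( 2 ∷  2 ∷  3 ∷  3 ∷  0 ∷  0 ∷ 12 ∷ 18 ∷ [])
  ∷ ( 0 ∷  0 ∷  0 ∷  0 ∷  5 ∷  0 ∷ 10 ∷ 14 ∷ [])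
  ∷ ( 2 ∷  0 ∷  0 ∷  0 ∷  9 ∷  0 ∷ 10 ∷ 18 ∷ [])
  ∷ ( 0 ∷  2 ∷  0 ∷  0 ∷  5 ∷  0 ∷ 10 ∷ 16 ∷ [])
  ∷ ( 1 ∷  2 ∷  0 ∷  0 ∷  5 ∷  0 ∷ 10 ∷ 10 ∷ [])
  ∷ ( 0 ∷  0 ∷  3 ∷  0 ∷  5 ∷  0 ∷ 10 ∷ 13 ∷ [])
  ∷ ( 1 ∷  0 ∷  3 ∷  0 ∷  5 ∷  0 ∷ 10 ∷  9 ∷ [])
  ∷ ( 0 ∷  2 ∷  3 ∷  0 ∷  5 ∷  0 ∷  8 ∷  8 ∷ [])
  ∷ ( 1 ∷  2 ∷  3 ∷  0 ∷  9 ∷  0 ∷  8 ∷  5 ∷ [])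
  ∷ ( 0 ∷  0 ∷  0 ∷  3 ∷  5 ∷  0 ∷ 10 ∷ 18 ∷ [])
  ∷ ( 1 ∷  0 ∷  0 ∷  3 ∷  9 ∷  0 ∷  8 ∷  6 ∷ [])
  ∷ ( 0 ∷  2 ∷  0 ∷  3 ∷  5 ∷  0 ∷ 10 ∷ 17 ∷ [])
  ∷ ( 2 ∷  2 ∷  0 ∷  3 ∷  5 ∷  0 ∷ 12 ∷  8 ∷ [])
  ∷ ( 0 ∷  0 ∷  3 ∷  3 ∷  5 ∷  0 ∷ 10 ∷ 11 ∷ [])
  ∷ ( 1 ∷  0 ∷  3 ∷  3 ∷  5 ∷  0 ∷ 10 ∷ 12 ∷ [])
  ∷ ( 0 ∷  2 ∷  3 ∷  3 ∷  5 ∷  0 ∷ 10 ∷  8 ∷ [])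
  ∷ ( 1 ∷  2 ∷  3 ∷  3 ∷  5 ∷  0 ∷ 10 ∷ 15 ∷ [])
  ∷ ( 0 ∷  0 ∷  0 ∷  0 ∷  0 ∷ 11 ∷  1 ∷  7 ∷ [])
  ∷ ( 1 ∷  0 ∷  0 ∷  0 ∷  0 ∷ 11 ∷  1 ∷ 17 ∷ [])
  ∷ ( 0 ∷  2 ∷  0 ∷  0 ∷  0 ∷ 11 ∷  1 ∷ 13 ∷ [])
  ∷ ( 1 ∷  2 ∷  0 ∷  0 ∷  0 ∷ 11 ∷  1 ∷ 12 ∷ [])
  ∷ ( 0 ∷  0 ∷  3 ∷  0 ∷  0 ∷ 11 ∷  1 ∷  8 ∷ [])
  ∷ ( 1 ∷  0 ∷  3 ∷  0 ∷  0 ∷ 11 ∷  1 ∷ 10 ∷ [])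
  ∷ ( 0 ∷  2 ∷  3 ∷  0 ∷  0 ∷ 11 ∷  1 ∷ 16 ∷ [])
  ∷ ( 1 ∷  2 ∷  3 ∷  0 ∷  0 ∷ 11 ∷  1 ∷ 15 ∷ [])
  ∷ ( 0 ∷  0 ∷  0 ∷  3 ∷  0 ∷ 11 ∷  1 ∷  6 ∷ [])
  ∷ ( 2 ∷  0 ∷  0 ∷  3 ∷  0 ∷ 11 ∷  1 ∷ 17 ∷ [])
  ∷ ( 0 ∷  2 ∷  0 ∷  3 ∷  0 ∷ 11 ∷  1 ∷ 11 ∷ [])
  ∷ ( 1 ∷  2 ∷  0 ∷  3 ∷  0 ∷ 11 ∷  1 ∷  9 ∷ [])
  ∷ ( 0 ∷  0 ∷  3 ∷  3 ∷  0 ∷ 11 ∷  1 ∷ 18 ∷ [])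
  ∷ ( 2 ∷  0 ∷  3 ∷  3 ∷  0 ∷ 11 ∷  1 ∷  5 ∷ [])
  ∷ ( 0 ∷  2 ∷  3 ∷  3 ∷  0 ∷ 11 ∷  1 ∷ 14 ∷ [])
  ∷ ( 1 ∷  2 ∷  3 ∷  3 ∷  0 ∷ 11 ∷  1 ∷  5 ∷ [])
  ∷ ( 0 ∷  0 ∷  0 ∷  0 ∷  5 ∷  3 ∷ 14 ∷ 11 ∷ [])
  ∷ ( 4 ∷  0 ∷  0 ∷  0 ∷  5 ∷  3 ∷ 14 ∷ 13 ∷ [])
  ∷ ( 0 ∷  2 ∷  0 ∷  0 ∷  5 ∷  3 ∷ 14 ∷ 16 ∷ [])
  ∷ ( 2 ∷  2 ∷  0 ∷  0 ∷  9 ∷  3 ∷ 10 ∷ 13 ∷ [])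
  ∷ ( 0 ∷  0 ∷  3 ∷  0 ∷  9 ∷ 11 ∷ 10 ∷ 17 ∷ [])
  ∷ ( 4 ∷  0 ∷  3 ∷  0 ∷  5 ∷  3 ∷ 14 ∷ 18 ∷ [])
  ∷ ( 0 ∷  2 ∷  3 ∷  0 ∷  9 ∷ 11 ∷ 10 ∷ 14 ∷ [])
  ∷ ( 4 ∷  2 ∷  3 ∷  0 ∷  5 ∷  3 ∷ 14 ∷ 14 ∷ [])
  ∷ ( 0 ∷  0 ∷  0 ∷  3 ∷  9 ∷  3 ∷ 10 ∷ 17 ∷ [])
  ∷ ( 4 ∷  0 ∷  0 ∷  3 ∷  5 ∷  3 ∷ 14 ∷ 17 ∷ [])
  ∷ ( 0 ∷  2 ∷  0 ∷  3 ∷  9 ∷ 11 ∷ 10 ∷ 11 ∷ [])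
  ∷ ( 4 ∷  2 ∷  0 ∷  3 ∷  5 ∷  3 ∷ 14 ∷  8 ∷ [])
  ∷ ( 0 ∷  0 ∷  3 ∷  3 ∷  9 ∷ 11 ∷ 10 ∷ 13 ∷ [])
  ∷ ( 2 ∷  0 ∷  3 ∷  3 ∷  9 ∷ 11 ∷ 10 ∷ 16 ∷ [])
  ∷ ( 0 ∷  2 ∷  3 ∷  3 ∷  9 ∷  3 ∷ 10 ∷ 11 ∷ [])
  ∷ ( 2 ∷  2 ∷  3 ∷  3 ∷  9 ∷  3 ∷ 10 ∷ 16 ∷ [])
  ∷ []

theorem4p3 : (p : ℕ) → Prime p → 23 ≤ p →
    Σ (List Congruence) (λ S →
    IsCovering S
    × All (λ m → Odd m × 1 < m) (moduli S)
    × countModulus p S ≡ p ∸ 5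
    × Unique (otherModuli p S))
theorem4p3 p p-prime 23≤p = S , covering , oddModuli , count , uniqueModuli
  where
  1<p : 1 < p
  1<p = <-≤-trans (s≤s (s≤s z≤n)) 23≤p

  p-coprime : ∀ {k} → 0 < k × k < 23 → Coprime p k
  p-coprime (0<k , k<23) = prime⇒coprime p-prime {{>-nonZero 0<k}} (<-≤-trans k<23 23≤p)

  open Assembly p {{>-nonZero (<-trans (s≤s z≤n) 1<p)}} smallPrimes 1<p 1<smallPrimes
    (VecAll.map p-coprime smallPrimes-range ∷ smallPrimes-coprime)
    (p-coprime (s≤s z≤n , s≤s (s≤s (s≤s z≤n))) ∷ smallPrimes-odd)
    -- Five classes mod `p` remain. The eight coordinates have 2^8 - 2 = 254 supports other than the
    -- empty one and that of `p` alone. `refl` computes the codes 2 to 255, and `tt` runs the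
    -- covering test.
    5 cubes 254 refl tt
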